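{- Let $Q_n$ be the para-chain square cactus of length $n$, and let $Q_n'$ be the graph obtained from $Q_n$ by attaching two pendant vertices to its end vertex $c_n$. For every $n\ge 3$, $$D(Q_n,x)=(x^3+2x^2+x)D(Q_{n-1},x)+(x^3+2x^2)D(Q_{n-2},x)+(x^3+3x^2)D(Q_{n-2}',x)+(2x^4+4x^3)D(Q_{n-3}',x),$$ with initial conditions $D(Q_1,x)=x^4+4x^3+6x^2$ and $D(Q_2,x)=x^7+7x^6+21x^5+29x^4+15x^3$.
   Context: For a finite simple graph $G=(V,E)$, a set $S\subseteq V$ is dominating if every vertex of $V\setminus S$ is adjacent to at least one vertex of $S$. Let $d(G,i)$ be the number of dominating sets of $G$ of cardinality $i$. The domination polynomial of $G$ is $D(G,x)=\sum_{i=\gamma(G)}^{|V|} d(G,i)x^i$, where $\gamma(G)$ is the minimum cardinality of a dominating set. The para-chain $Q_n$ is the chain of $n$ squares ($4$-cycles), consecutive squares sharing a cut-vertex, in which the two cut-vertices of each internal square are non-adjacent. Concretely, $Q_n$ has vertices $c_0,\dots,c_n,a_1,\dots,a_n,b_1,\dots,b_n$ and edges $c_{i-1}a_i,\ a_ic_i,\ c_ib_i,\ b_ic_{i-1}$ for $1\le i\le n$; $Q_0$ is the single vertex $c_0$. The graph $Q_n'$ ($n\ge 0$) is obtained from $Q_n$ by adding two new vertices, each joined only to $c_n$; in particular $Q_0'$ is the path on three vertices. -}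

module Defs where

open import Data.Empty using (⊥)
open import Data.Fin.Base using (Fin; zero; suc; inject₁; fromℕ)
import Data.Fin.Properties as Fin
open import Data.Fin.Subset using (Subset; inside; outside; _∈_; _∉_; ∣_∣)
open import Data.Fin.Subset.Properties using (_∈?_)
open import Data.List.Base
  using (List; []; _∷_; _++_; map; filter; length; foldr; applyUpTo)
open import Data.List.Extrema using (min)
open import Data.Nat.Base as ℕ using (ℕ; zero; suc)
import Data.Nat.Properties as ℕ
open import Data.Product.Base using (∃; _×_; _,_)
open import Data.Sum.Base using (_⊎_; inj₁; inj₂)
open import Data.Sum.Function.Propositional using (_⊎-↔_)
open import Data.Vec.Base using ([]; _∷_)
open import Function.Base using (_∘_)
open import Function.Bundles using (_↔_; mk↔ₛ′; module Inverse)
open import Function.Construct.Composition using (_↔-∘_)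
open import Function.Construct.Identity using (↔-id)
open import Function.Construct.Symmetry using (↔-sym)
open import Function.Properties.Inverse using (↔⇒↣)
open import Relation.Binary.Construct.Closure.Symmetric
  using (SymClosure; fwd; bwd; symmetric)
open import Relation.Binary.Definitions
  using (Decidable; DecidableEquality; Symmetric)
open import Relation.Binary.PropositionalEquality
  using (_≡_; refl; sym; subst)
open import Relation.Nullary using (Dec; yes; no; ¬_; ¬?; map′; _×-dec_; _⊎-dec_; _→-dec_)
open import Relation.Nullary.Decidable using (via-injection)
import Relation.Unary as U

-- Coefficient lists, constant term first.  Trailing zeros are allowed, so
-- polynomials are compared with _≈_ rather than _≡_.
ℕ[X] : Set
ℕ[X] = List ℕ

coeff : ℕ[X] → ℕ → ℕ
coeff []      _       = 0
coeff (a ∷ p) zero    = a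
coeff (a ∷ p) (suc k) = coeff p k

infix 4 _≈_
_≈_ : ℕ[X] → ℕ[X] → Set
p ≈ q = ∀ k → coeff p k ≡ coeff q k

infixl 6 _+_
infixl 7 _*_
infixr 7 _·_
infixr 8 _^_

_+_ : ℕ[X] → ℕ[X] → ℕ[X]
[]      + q       = q
(a ∷ p) + []      = a ∷ p
(a ∷ p) + (b ∷ q) = a ℕ.+ b ∷ p + q

_·_ : ℕ → ℕ[X] → ℕ[X]
a · p = map (a ℕ.*_) p

_*_ : ℕ[X] → ℕ[X] → ℕ[X]
[]      * q = []
(a ∷ p) * q = a · q + (0 ∷ p * q)

_^_ : ℕ[X] → ℕ → ℕ[X]
p ^ zero  = 1 ∷ []
p ^ suc k = p * p ^ k

X : ℕ[X]
X = 0 ∷ 1 ∷ []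

sum : List ℕ[X] → ℕ[X]
sum = foldr _+_ []

record Graph : Set₁ where
  infix 4 _~_ _~?_
  field
    V        : Set
    order    : ℕ
    enum     : V ↔ Fin order
    _~_      : V → V → Set
    _~?_     : Decidable _~_
    ~-sym    : Symmetric _~_
    ~-irrefl : ∀ {v} → ¬ (v ~ v)

  open Inverse enum public using () renaming
    ( to to index; from to vertex
    ; strictlyInverseˡ to index-vertex; strictlyInverseʳ to vertex-index )

  _≟ᵥ_ : DecidableEquality V
  _≟ᵥ_ = via-injection (↔⇒↣ enum) Fin._≟_

  all? : {P : V → Set} → U.Decidable P → Dec (∀ v → P v)
  all? {P} P? = map′ (λ f v → subst P (vertex-index v) (f (index v)))
                     (λ f i → f (vertex i))
                     (Fin.all? (P? ∘ vertex))

  any? : {P : V → Set} → U.Decidable P → Dec (∃ P)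
  any? {P} P? = map′ (λ (i , p) → vertex i , p)
                     (λ (v , p) → index v , subst P (sym (vertex-index v)) p)
                     (Fin.any? (P? ∘ vertex))

allSubsets : ∀ n → List (Subset n)
allSubsets zero    = [] ∷ []
allSubsets (suc n) =
  map (outside ∷_) (allSubsets n) ++ map (inside ∷_) (allSubsets n)

module _ (G : Graph) where
  open Graph G

  -- A set of vertices is a subset of the indices given by enum.
  Dominating : Subset order → Set
  Dominating S = ∀ v → index v ∉ S → ∃ λ u → index u ∈ S × v ~ u

  dominating? : U.Decidable Dominating
  dominating? S = all? λ v → ¬? (index v ∈? S) →-dec
                  any? λ u → (index u ∈? S) ×-dec (v ~? u)

  dominatingSets : List (Subset order)
  dominatingSets = filter dominating? (allSubsets order)

  d : ℕ → ℕ
  d i = length (filter (λ S → ∣ S ∣ ℕ.≟ i) dominatingSets)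

  -- The default value order is attained, since V itself is dominating.
  γ : ℕ
  γ = min ℕ.≤-totalOrder order (map ∣_∣ dominatingSets)

  -- The sum over γ ≤ i ≤ order.
  D : ℕ[X]
  D = sum (applyUpTo (λ k → d (γ ℕ.+ k) · X ^ (γ ℕ.+ k)) (suc order ℕ.∸ γ))

-- For i : Fin n, a i and b i are the vertices usually written a_{i+1} and
-- b_{i+1}; the cut-vertices of their square are c (inject₁ i) and c (suc i).
data QVertex (n : ℕ) : Set where
  c   : Fin (suc n) → QVertex n
  a b : Fin n → QVertex n

data QEdge {n : ℕ} : QVertex n → QVertex n → Set where
  c⁻a : ∀ i → QEdge (c (inject₁ i)) (a i)
  ac  : ∀ i → QEdge (a i) (c (suc i))
  cb  : ∀ i → QEdge (c (suc i)) (b i)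
  bc⁻ : ∀ i → QEdge (b i) (c (inject₁ i))

QEdge? : ∀ {n} → Decidable (QEdge {n})
QEdge? (c j) (c k) = no λ ()
QEdge? (c j) (a i) with j Fin.≟ inject₁ i
... | yes refl = yes (c⁻a i)
... | no  j≢i  = no λ { (c⁻a _) → j≢i refl }
QEdge? (c j) (b i) with j Fin.≟ suc i
... | yes refl = yes (cb i)
... | no  j≢i  = no λ { (cb _) → j≢i refl }
QEdge? (a i) (c j) with j Fin.≟ suc i
... | yes refl = yes (ac i)
... | no  j≢i  = no λ { (ac _) → j≢i refl }
QEdge? (a i) (a j) = no λ ()
QEdge? (a i) (b j) = no λ ()
QEdge? (b i) (c j) with j Fin.≟ inject₁ i
... | yes refl = yes (bc⁻ i)
... | no  j≢i  = no λ { (bc⁻ _) → j≢i refl }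
QEdge? (b i) (a j) = no λ ()
QEdge? (b i) (b j) = no λ ()

QAdj? : ∀ {n} → Decidable (SymClosure (QEdge {n}))
QAdj? u v = map′ (λ { (inj₁ e) → fwd e ; (inj₂ e) → bwd e })
                 (λ { (fwd e) → inj₁ e ; (bwd e) → inj₂ e })
                 (QEdge? u v ⊎-dec QEdge? v u)

QAdj-irrefl : ∀ {n} {v : QVertex n} → ¬ SymClosure QEdge v v
QAdj-irrefl {v = c _} (fwd ())
QAdj-irrefl {v = c _} (bwd ())
QAdj-irrefl {v = a _} (fwd ())
QAdj-irrefl {v = a _} (bwd ())
QAdj-irrefl {v = b _} (fwd ())
QAdj-irrefl {v = b _} (bwd ())

-- The vertices are listed square by square: c₀, a₁, b₁, c₁, a₂, b₂, c₂, …
QVertex↔⊎ : ∀ n → QVertex n ↔ (Fin 1 ⊎ Fin n × Fin 3)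
QVertex↔⊎ n = mk↔ₛ′ to from to∘from from∘to
  where
  to : QVertex n → Fin 1 ⊎ Fin n × Fin 3
  to (c zero)    = inj₁ zero
  to (c (suc i)) = inj₂ (i , suc (suc zero))
  to (a i)       = inj₂ (i , zero)
  to (b i)       = inj₂ (i , suc zero)

  from : Fin 1 ⊎ Fin n × Fin 3 → QVertex n
  from (inj₁ _)                    = c zero
  from (inj₂ (i , zero))           = a i
  from (inj₂ (i , suc zero))       = b i
  from (inj₂ (i , suc (suc zero))) = c (suc i)

  to∘from : ∀ x → to (from x) ≡ x
  to∘from (inj₁ zero)                 = refl
  to∘from (inj₂ (i , zero))           = refl
  to∘from (inj₂ (i , suc zero))       = refl
  to∘from (inj₂ (i , suc (suc zero))) = refl

  from∘to : ∀ v → from (to v) ≡ v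
  from∘to (c zero)    = refl
  from∘to (c (suc i)) = refl
  from∘to (a i)       = refl
  from∘to (b i)       = refl

QVertex↔Fin : ∀ n → QVertex n ↔ Fin (1 ℕ.+ n ℕ.* 3)
QVertex↔Fin n =
  ↔-sym (Fin.+↔⊎ {1}) ↔-∘ ((↔-id _ ⊎-↔ ↔-sym Fin.*↔×) ↔-∘ QVertex↔⊎ n)

Q : ℕ → Graph
Q n = record
  { V        = QVertex n
  ; order    = 1 ℕ.+ n ℕ.* 3
  ; enum     = QVertex↔Fin n
  ; _~_      = SymClosure QEdge
  ; _~?_     = QAdj?
  ; ~-sym    = symmetric QEdge
  ; ~-irrefl = QAdj-irrefl
  }

module _ (G : Graph) (w : Graph.V G) where
  open Graph G

  PendantAdj : V ⊎ Fin 2 → V ⊎ Fin 2 → Set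
  PendantAdj (inj₁ u) (inj₁ v) = u ~ v
  PendantAdj (inj₁ u) (inj₂ _) = u ≡ w
  PendantAdj (inj₂ _) (inj₁ v) = v ≡ w
  PendantAdj (inj₂ _) (inj₂ _) = ⊥

  PendantAdj? : Decidable PendantAdj
  PendantAdj? (inj₁ u) (inj₁ v) = u ~? v
  PendantAdj? (inj₁ u) (inj₂ _) = u ≟ᵥ w
  PendantAdj? (inj₂ _) (inj₁ v) = v ≟ᵥ w
  PendantAdj? (inj₂ _) (inj₂ _) = no λ ()

  PendantAdj-sym : Symmetric PendantAdj
  PendantAdj-sym {inj₁ _} {inj₁ _} e = ~-sym e
  PendantAdj-sym {inj₁ _} {inj₂ _} e = e
  PendantAdj-sym {inj₂ _} {inj₁ _} e = e

  PendantAdj-irrefl : ∀ {v} → ¬ PendantAdj v v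
  PendantAdj-irrefl {inj₁ _} e = ~-irrefl e

  attachTwoPendants : Graph
  attachTwoPendants = record
    { V        = V ⊎ Fin 2
    ; order    = order ℕ.+ 2
    ; enum     = ↔-sym Fin.+↔⊎ ↔-∘ (enum ⊎-↔ ↔-id _)
    ; _~_      = PendantAdj
    ; _~?_     = PendantAdj?
    ; ~-sym    = λ {u} {v} → PendantAdj-sym {u} {v}
    ; ~-irrefl = λ {v} → PendantAdj-irrefl {v}
    }

Q′ : ℕ → Graph
Q′ n = attachTwoPendants (Q n) (c (fromℕ n))

{-# OPTIONS --safe #-}

-- Prepending a square to the chain acts linearly on the generating functions of the
-- sets dominating everything in the chain, with the first cut-vertex c₀ being in the
-- set or not and being dominated from outside or not.  The operator does not depend
-- on what is attached at the far end cₙ, so it is the same for Q and Q′; a linear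
-- relation between the generating functions of Q₃, Q₂, Q₁, Q′₁ and Q′₀ that holds
-- for each state of c₀ therefore propagates to all longer chains.

module Submission where

open import Defs
open import Data.Bool.Base using (Bool; true; false; _∧_; _∨_; if_then_else_; T)
open import Data.Bool.Properties using (T?; T-∧; T-∨; T-≡; ∧-assoc)
open import Data.Fin.Base using (Fin; zero; suc; inject₁; fromℕ)
open import Data.Fin.Subset using (Subset; inside; outside; _∈_; _∉_; ∣_∣)
open import Data.Fin.Subset.Properties using (∣p∣≤n)
open import Data.List.Base
  using (List; []; _∷_; _++_; map; filter; length; applyUpTo)
open import Data.List.Extrema using (min≤xs)
open import Data.List.Properties using (filter-++; filter-≐; filter-none; length-++; length-map)
import Data.List.Relation.Unary.All as All
import Data.List.Relation.Unary.All.Properties as All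
open import Data.Nat.Base as ℕ using (ℕ; zero; suc; _≤_; _<_; _∸_; s≤s; z≤n)
import Data.Nat.Properties as ℕ
open import Algebra.Properties.CommutativeSemigroup ℕ.+-commutativeSemigroup
  using (interchange)
open import Data.Product.Base using (∃; _×_; _,_)
open import Data.Sum.Base using (_⊎_; inj₁; inj₂)
open import Data.Vec.Base using ([]; _∷_; lookup)
open import Data.Vec.Properties using ([]=⇒lookup; lookup⇒[]=)
open import Function.Base using (_∘_; _$_)
open import Function.Bundles using (_⇔_; mk⇔; module Equivalence)
open import Function.Construct.Composition using (_⇔-∘_)
open import Level using (0ℓ)
open import Relation.Binary.Bundles using (Setoid)
open import Relation.Binary.Construct.Closure.Symmetric using (SymClosure; fwd; bwd)
open import Relation.Binary.PropositionalEquality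
  using (_≡_; _≢_; refl; sym; trans; cong; cong₂; subst; module ≡-Reasoning)
import Relation.Binary.Reasoning.Setoid as SetoidReasoning
open import Relation.Nullary using (Dec; yes; no; does; ¬_; map′; contradiction; _×-dec_)
open import Relation.Nullary.Decidable using (does-⇔; from-yes)
import Relation.Unary as U

-- Polynomials up to equality of coefficients.

≈-setoid : Setoid 0ℓ 0ℓ
≈-setoid = record
  { _≈_           = _≈_
  ; isEquivalence = record
    { refl  = λ _ → refl
    ; sym   = λ p≈q k → sym (p≈q k)
    ; trans = λ p≈q q≈r k → trans (p≈q k) (q≈r k)
    }
  }

module ≈-Reasoning = SetoidReasoning ≈-setoid

∷-cong : ∀ x {p q} → p ≈ q → x ∷ p ≈ x ∷ q
∷-cong x p≈q zero    = refl
∷-cong x p≈q (suc k) = p≈q k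

≈[]? : ∀ p → Dec (p ≈ [])
≈[]? []      = yes λ _ → refl
≈[]? (x ∷ p) = map′ (λ { (refl , p≈[]) zero → refl ; (refl , p≈[]) (suc k) → p≈[] k })
                    (λ p≈[] → p≈[] 0 , p≈[] ∘ suc)
                    (x ℕ.≟ 0 ×-dec ≈[]? p)

infix 4 _≈?_
-- Coefficient lists are finite, so only finitely many coefficients need comparing. Identities
-- between closed polynomials can then be settled by evaluation, through `from-yes`.
_≈?_ : ∀ p q → Dec (p ≈ q)
[]      ≈? q       = map′ (λ q≈[] k → sym (q≈[] k)) (λ []≈q k → sym ([]≈q k)) (≈[]? q)
(x ∷ p) ≈? []      = ≈[]? (x ∷ p)
(x ∷ p) ≈? (y ∷ q) = map′ (λ { (refl , p≈q) → ∷-cong x p≈q })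
                          (λ p≈q → p≈q 0 , p≈q ∘ suc)
                          (x ℕ.≟ y ×-dec p ≈? q)

coeff-+ : ∀ p q k → coeff (p + q) k ≡ coeff p k ℕ.+ coeff q k
coeff-+ []      q       k       = refl
coeff-+ (x ∷ p) []      k       = sym (ℕ.+-identityʳ _)
coeff-+ (x ∷ p) (y ∷ q) zero    = refl
coeff-+ (x ∷ p) (y ∷ q) (suc k) = coeff-+ p q k

coeff-· : ∀ x p k → coeff (x · p) k ≡ x ℕ.* coeff p k
coeff-· x []      k       = sym (ℕ.*-zeroʳ x)
coeff-· x (y ∷ p) zero    = refl
coeff-· x (y ∷ p) (suc k) = coeff-· x p k

coeff-∷* : ∀ x p q k → coeff ((x ∷ p) * q) k ≡ x ℕ.* coeff q k ℕ.+ coeff (0 ∷ p * q) k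
coeff-∷* x p q k =
  trans (coeff-+ (x · q) _ k) (cong (ℕ._+ coeff (0 ∷ p * q) k) (coeff-· x q k))

-- The polynomials are explicit arguments because `_≈_` unfolds to equations between coefficients,
-- which do not determine them for unification.
+-cong : ∀ p q p′ q′ → p ≈ p′ → q ≈ q′ → p + q ≈ p′ + q′
+-cong p q p′ q′ p≈p′ q≈q′ k = begin
  coeff (p + q) k              ≡⟨ coeff-+ p q k ⟩
  coeff p k ℕ.+ coeff q k      ≡⟨ cong₂ ℕ._+_ (p≈p′ k) (q≈q′ k) ⟩
  coeff p′ k ℕ.+ coeff q′ k    ≡⟨ coeff-+ p′ q′ k ⟨
  coeff (p′ + q′) k            ∎
  where open ≡-Reasoning

+-interchange : ∀ p q r s → (p + q) + (r + s) ≈ (p + r) + (q + s)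
+-interchange p q r s k = begin
  coeff ((p + q) + (r + s)) k                            ≡⟨ expand p q r s ⟩
  (coeff p k ℕ.+ coeff q k) ℕ.+ (coeff r k ℕ.+ coeff s k)
    ≡⟨ interchange (coeff p k) (coeff q k) (coeff r k) (coeff s k) ⟩
  (coeff p k ℕ.+ coeff r k) ℕ.+ (coeff q k ℕ.+ coeff s k)  ≡⟨ expand p r q s ⟨
  coeff ((p + r) + (q + s)) k                            ∎
  where
  open ≡-Reasoning
  expand : ∀ p q r s → coeff ((p + q) + (r + s)) k ≡
                       (coeff p k ℕ.+ coeff q k) ℕ.+ (coeff r k ℕ.+ coeff s k)
  expand p q r s = trans (coeff-+ (p + q) (r + s) k)
                         (cong₂ ℕ._+_ (coeff-+ p q k) (coeff-+ r s k))

*-congˡ : ∀ p q r → q ≈ r → p * q ≈ p * r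
*-congˡ []      q r q≈r k = refl
*-congˡ (x ∷ p) q r q≈r k = begin
  coeff ((x ∷ p) * q) k                      ≡⟨ coeff-∷* x p q k ⟩
  x ℕ.* coeff q k ℕ.+ coeff (0 ∷ p * q) k
    ≡⟨ cong₂ (λ u v → x ℕ.* u ℕ.+ v) (q≈r k) (∷-cong 0 (*-congˡ p q r q≈r) k) ⟩
  x ℕ.* coeff r k ℕ.+ coeff (0 ∷ p * r) k    ≡⟨ coeff-∷* x p r k ⟨
  coeff ((x ∷ p) * r) k                      ∎
  where open ≡-Reasoning

*-distribˡ-+ : ∀ p q r → p * (q + r) ≈ p * q + p * r
*-distribˡ-+ []      q r k = refl
*-distribˡ-+ (x ∷ p) q r k = begin
  coeff ((x ∷ p) * (q + r)) k
    ≡⟨ coeff-∷* x p (q + r) k ⟩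
  x ℕ.* coeff (q + r) k ℕ.+ coeff (0 ∷ p * (q + r)) k
    ≡⟨ cong₂ ℕ._+_ (trans (cong (x ℕ.*_) (coeff-+ q r k)) (ℕ.*-distribˡ-+ x (coeff q k) (coeff r k)))
                   (trans (∷-cong 0 (*-distribˡ-+ p q r) k) (coeff-+ (0 ∷ p * q) (0 ∷ p * r) k)) ⟩
  (x ℕ.* coeff q k ℕ.+ x ℕ.* coeff r k) ℕ.+ (coeff (0 ∷ p * q) k ℕ.+ coeff (0 ∷ p * r) k)
    ≡⟨ interchange (x ℕ.* coeff q k) _ _ _ ⟩
  (x ℕ.* coeff q k ℕ.+ coeff (0 ∷ p * q) k) ℕ.+ (x ℕ.* coeff r k ℕ.+ coeff (0 ∷ p * r) k)
    ≡⟨ cong₂ ℕ._+_ (coeff-∷* x p q k) (coeff-∷* x p r k) ⟨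
  coeff ((x ∷ p) * q) k ℕ.+ coeff ((x ∷ p) * r) k
    ≡⟨ coeff-+ ((x ∷ p) * q) ((x ∷ p) * r) k ⟨
  coeff ((x ∷ p) * q + (x ∷ p) * r) k
    ∎
  where open ≡-Reasoning

-- Prepending `0` is multiplication by `X`, which commutes with multiplication by `p`. This lets a
-- factor be pulled out of the `inside` half of `∑`.
*-shiftʳ : ∀ p q → p * (0 ∷ q) ≈ 0 ∷ p * q
*-shiftʳ []      q zero    = refl
*-shiftʳ []      q (suc k) = refl
*-shiftʳ (x ∷ p) q zero    = trans (coeff-∷* x p (0 ∷ q) 0) (trans (ℕ.+-identityʳ _) (ℕ.*-zeroʳ x))
*-shiftʳ (x ∷ p) q (suc k) = begin
  coeff ((x ∷ p) * (0 ∷ q)) (suc k)            ≡⟨ coeff-∷* x p (0 ∷ q) (suc k) ⟩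
  x ℕ.* coeff q k ℕ.+ coeff (p * (0 ∷ q)) k    ≡⟨ cong (x ℕ.* coeff q k ℕ.+_) (*-shiftʳ p q k) ⟩
  x ℕ.* coeff q k ℕ.+ coeff (0 ∷ p * q) k      ≡⟨ coeff-∷* x p q k ⟨
  coeff ((x ∷ p) * q) k                        ∎
  where open ≡-Reasoning

-- Coefficients of powers of `X` and of finite sums.

coeff-X^-same : ∀ i → coeff (X ^ i) i ≡ 1
coeff-X^-other : ∀ i k → i ≢ k → coeff (X ^ i) k ≡ 0

coeff-X*-suc : ∀ p k → coeff (X * p) (suc k) ≡ coeff p k
coeff-X*-suc p k = begin
  coeff (X * p) (suc k)                     ≡⟨ coeff-∷* 0 (1 ∷ []) p (suc k) ⟩
  coeff ((1 ∷ []) * p) k                    ≡⟨ coeff-∷* 1 [] p k ⟩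
  1 ℕ.* coeff p k ℕ.+ coeff (0 ∷ []) k      ≡⟨ cong₂ ℕ._+_ (ℕ.*-identityˡ (coeff p k)) (coeff-0 k) ⟩
  coeff p k ℕ.+ 0                           ≡⟨ ℕ.+-identityʳ _ ⟩
  coeff p k                                 ∎
  where
  open ≡-Reasoning
  coeff-0 : ∀ k → coeff (0 ∷ []) k ≡ 0
  coeff-0 zero    = refl
  coeff-0 (suc k) = refl

coeff-X^-same zero    = refl
coeff-X^-same (suc i) = trans (coeff-X*-suc (X ^ i) i) (coeff-X^-same i)

coeff-X^-other zero    zero    0≢0 = contradiction refl 0≢0
coeff-X^-other zero    (suc k) _   = refl
coeff-X^-other (suc i) zero    _   = coeff-∷* 0 (1 ∷ []) (X ^ i) 0
coeff-X^-other (suc i) (suc k) i≢k =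
  trans (coeff-X*-suc (X ^ i) k) (coeff-X^-other i k (i≢k ∘ cong suc))

module _ (k : ℕ) where

  coeff-sum-zero : ∀ g l → (∀ i → i < l → coeff (g i) k ≡ 0) →
                   coeff (sum (applyUpTo g l)) k ≡ 0
  coeff-sum-zero g zero    g≡0 = refl
  coeff-sum-zero g (suc l) g≡0 =
    trans (coeff-+ (g 0) _ k)
          (cong₂ ℕ._+_ (g≡0 0 (s≤s z≤n)) (coeff-sum-zero (g ∘ suc) l (λ i i<l → g≡0 (suc i) (s≤s i<l))))

  coeff-sum-single : ∀ g {l} {j} → j < l → (∀ i → i ≢ j → coeff (g i) k ≡ 0) →
                     coeff (sum (applyUpTo g l)) k ≡ coeff (g j) k
  coeff-sum-single g {suc l} {zero} _ g≡0 =
    trans (coeff-+ (g 0) _ k)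
          (trans (cong (coeff (g 0) k ℕ.+_) (coeff-sum-zero (g ∘ suc) l (λ i _ → g≡0 (suc i) λ ())))
                 (ℕ.+-identityʳ _))
  coeff-sum-single g {suc l} {suc j} (s≤s j<l) g≡0 =
    trans (coeff-+ (g 0) _ k)
          (cong₂ ℕ._+_ (g≡0 0 λ ())
                       (coeff-sum-single (g ∘ suc) j<l (λ i i≢j → g≡0 (suc i) (i≢j ∘ ℕ.suc-injective))))

-- Generating functions over subsets.

filter-map : ∀ {A B : Set} {P : U.Pred B 0ℓ} (P? : U.Decidable P) (f : A → B) xs →
             filter P? (map f xs) ≡ map f (filter (P? ∘ f) xs)
filter-map P? f []       = refl
filter-map P? f (x ∷ xs) with does (P? (f x))
... | true  = cong (f x ∷_) (filter-map P? f xs)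
... | false = filter-map P? f xs

-- The sum of f S X^|S| over all S.
∑ : ∀ n → (Subset n → ℕ[X]) → ℕ[X]
∑ zero    f = f []
∑ (suc n) f = ∑ n (f ∘ (outside ∷_)) + (0 ∷ ∑ n (f ∘ (inside ∷_)))

⟦_⟧ : Bool → ℕ[X]
⟦ y ⟧ = if y then 1 ∷ [] else []

∑-cong : ∀ n {f g : Subset n → ℕ[X]} → (∀ S → f S ≈ g S) → ∑ n f ≈ ∑ n g
∑-cong zero    f≈g = f≈g []
∑-cong (suc n) {f} {g} f≈g =
  +-cong (∑ n (f ∘ (outside ∷_))) (0 ∷ ∑ n (f ∘ (inside ∷_)))
         (∑ n (g ∘ (outside ∷_))) (0 ∷ ∑ n (g ∘ (inside ∷_)))
         (∑-cong n (f≈g ∘ (outside ∷_))) (∷-cong 0 (∑-cong n (f≈g ∘ (inside ∷_))))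

∑-zero : ∀ n → ∑ n (λ _ → []) ≈ []
∑-zero zero    k       = refl
∑-zero (suc n) zero    =
  trans (coeff-+ (∑ n _) (0 ∷ ∑ n _) 0) (trans (ℕ.+-identityʳ _) (∑-zero n 0))
∑-zero (suc n) (suc k) =
  trans (coeff-+ (∑ n _) (0 ∷ ∑ n _) (suc k)) (cong₂ ℕ._+_ (∑-zero n (suc k)) (∑-zero n k))

∑-+ : ∀ n (f g : Subset n → ℕ[X]) → ∑ n (λ S → f S + g S) ≈ ∑ n f + ∑ n g
∑-+ zero    f g k = refl
∑-+ (suc n) f g = begin
  ∑ n (λ S → f₀ S + g₀ S) + (0 ∷ ∑ n (λ S → f₁ S + g₁ S))
    ≈⟨ +-cong (∑ n (λ S → f₀ S + g₀ S)) (0 ∷ ∑ n (λ S → f₁ S + g₁ S))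
              (∑ n f₀ + ∑ n g₀) (0 ∷ ∑ n f₁ + ∑ n g₁)
              (∑-+ n f₀ g₀) (∷-cong 0 (∑-+ n f₁ g₁)) ⟩
  (∑ n f₀ + ∑ n g₀) + ((0 ∷ ∑ n f₁) + (0 ∷ ∑ n g₁))
    ≈⟨ +-interchange (∑ n f₀) (∑ n g₀) (0 ∷ ∑ n f₁) (0 ∷ ∑ n g₁) ⟩
  (∑ n f₀ + (0 ∷ ∑ n f₁)) + (∑ n g₀ + (0 ∷ ∑ n g₁))
    ∎
  where
  open ≈-Reasoning
  f₀ = f ∘ (outside ∷_)
  f₁ = f ∘ (inside ∷_)
  g₀ = g ∘ (outside ∷_)
  g₁ = g ∘ (inside ∷_)

∑-* : ∀ n p (f : Subset n → ℕ[X]) → ∑ n (λ S → p * f S) ≈ p * ∑ n f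
∑-* zero    p f k = refl
∑-* (suc n) p f = begin
  ∑ n (λ S → p * f₀ S) + (0 ∷ ∑ n (λ S → p * f₁ S))
    ≈⟨ +-cong (∑ n (λ S → p * f₀ S)) (0 ∷ ∑ n (λ S → p * f₁ S)) (p * ∑ n f₀) (0 ∷ p * ∑ n f₁)
              (∑-* n p f₀) (∷-cong 0 (∑-* n p f₁)) ⟩
  p * ∑ n f₀ + (0 ∷ p * ∑ n f₁)
    ≈⟨ +-cong (p * ∑ n f₀) (p * (0 ∷ ∑ n f₁)) (p * ∑ n f₀) (0 ∷ p * ∑ n f₁)
              (λ _ → refl) (*-shiftʳ p (∑ n f₁)) ⟨
  p * ∑ n f₀ + p * (0 ∷ ∑ n f₁)
    ≈⟨ *-distribˡ-+ p (∑ n f₀) (0 ∷ ∑ n f₁) ⟨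
  p * (∑ n f₀ + (0 ∷ ∑ n f₁))
    ∎
  where
  open ≈-Reasoning
  f₀ = f ∘ (outside ∷_)
  f₁ = f ∘ (inside ∷_)

module _ (k : ℕ) where

  count : ∀ {n} {P : U.Pred (Subset n) 0ℓ} → U.Decidable P → List (Subset n) → ℕ
  count P? xs = length (filter (λ S → ∣ S ∣ ℕ.≟ k) (filter P? xs))

  count-++ : ∀ {n} {P : U.Pred (Subset n) 0ℓ} (P? : U.Decidable P) xs ys →
             count P? (xs ++ ys) ≡ count P? xs ℕ.+ count P? ys
  count-++ P? xs ys = begin
    length (filter _ (filter P? (xs ++ ys)))
      ≡⟨ cong (length ∘ filter _) (filter-++ P? xs ys) ⟩
    length (filter _ (filter P? xs ++ filter P? ys))
      ≡⟨ cong length (filter-++ _ (filter P? xs) _) ⟩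
    length (filter _ (filter P? xs) ++ filter _ (filter P? ys))
      ≡⟨ length-++ (filter _ (filter P? xs)) ⟩
    count P? xs ℕ.+ count P? ys
      ∎
    where open ≡-Reasoning

  count-map : ∀ {n} (x : Bool) {P : U.Pred (Subset (suc n)) 0ℓ} (P? : U.Decidable P) xs →
    count P? (map (x ∷_) xs) ≡
    length (filter (λ S → ∣ x ∷ S ∣ ℕ.≟ k) (filter (P? ∘ (x ∷_)) xs))
  count-map x P? xs = begin
    length (filter _ (filter P? (map (x ∷_) xs)))
      ≡⟨ cong (length ∘ filter _) (filter-map P? (x ∷_) xs) ⟩
    length (filter _ (map (x ∷_) ys))
      ≡⟨ cong length (filter-map (λ S → ∣ S ∣ ℕ.≟ k) (x ∷_) ys) ⟩
    length (map (x ∷_) (filter (λ S → ∣ x ∷ S ∣ ℕ.≟ k) ys))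
      ≡⟨ length-map (x ∷_) (filter (λ S → ∣ x ∷ S ∣ ℕ.≟ k) ys) ⟩
    length (filter (λ S → ∣ x ∷ S ∣ ℕ.≟ k) ys)
      ∎
    where
    open ≡-Reasoning
    ys = filter (P? ∘ (x ∷_)) xs

-- Induction on `n`, splitting the subsets by their first entry as `allSubsets` does. Those with
-- first entry `inside` have one element more, which the shift by `0 ∷` records.
coeff-∑ : ∀ n {P : U.Pred (Subset n) 0ℓ} (P? : U.Decidable P) k →
          coeff (∑ n (λ S → ⟦ does (P? S) ⟧)) k ≡ count k P? (allSubsets n)
coeff-∑ zero    P? k with does (P? [])
coeff-∑ zero    P? zero    | true  = refl
coeff-∑ zero    P? (suc k) | true  = refl
coeff-∑ zero    P? k       | false = refl
coeff-∑ (suc n) P? k = begin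
  coeff (∑ n _ + (0 ∷ ∑ n _)) k
    ≡⟨ coeff-+ (∑ n _) (0 ∷ ∑ n _) k ⟩
  coeff (∑ n _) k ℕ.+ coeff (0 ∷ ∑ n (λ S → ⟦ does (P? (inside ∷ S)) ⟧)) k
    ≡⟨ cong₂ ℕ._+_ (trans (coeff-∑ n (P? ∘ (outside ∷_)) k)
                          (sym (count-map k outside P? (allSubsets n))))
                   (inside-part k) ⟩
  count k P? (map (outside ∷_) (allSubsets n)) ℕ.+ count k P? (map (inside ∷_) (allSubsets n))
    ≡⟨ count-++ k P? (map (outside ∷_) (allSubsets n)) _ ⟨
  count k P? (allSubsets (suc n))
    ∎
  where
  open ≡-Reasoning
  inside-part : ∀ k → coeff (0 ∷ ∑ n (λ S → ⟦ does (P? (inside ∷ S)) ⟧)) k ≡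
                      count k P? (map (inside ∷_) (allSubsets n))
  inside-part zero = sym (trans (count-map 0 inside P? (allSubsets n))
    (cong length (filter-none (λ S → ∣ inside ∷ S ∣ ℕ.≟ 0)
      (All.universal (λ _ ()) (filter (P? ∘ (inside ∷_)) (allSubsets n))))))
  inside-part (suc k) = trans (coeff-∑ n (P? ∘ (inside ∷_)) k)
    (sym (trans (count-map (suc k) inside P? (allSubsets n))
      (cong length (filter-≐ _ (λ S → ∣ S ∣ ℕ.≟ k) (ℕ.suc-injective , cong suc)
        (filter (P? ∘ (inside ∷_)) (allSubsets n))))))

-- The domination polynomial as a generating function.

module _ (G : Graph) where
  open Graph G using (order)

  -- `γ G` bounds the size of every dominating set from below, and `order` bounds it from above.
  d≡0 : ∀ k → ¬ (γ G ≤ k × k ≤ order) → d G k ≡ 0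
  d≡0 k k∉ = cong length (filter-none (λ S → ∣ S ∣ ℕ.≟ k)
    (All.map (λ { {S} γ≤∣S∣ refl → k∉ (γ≤∣S∣ , ∣p∣≤n S) })
             (All.map⁻ (min≤xs ℕ.≤-totalOrder order (map ∣_∣ (dominatingSets G))))))

  term : ℕ → ℕ[X]
  term j = d G (γ G ℕ.+ j) · X ^ (γ G ℕ.+ j)

  coeff-term-other : ∀ k j → γ G ℕ.+ j ≢ k → coeff (term j) k ≡ 0
  coeff-term-other k j ≢k =
    trans (coeff-· (d G _) (X ^ (γ G ℕ.+ j)) k)
          (trans (cong (d G _ ℕ.*_) (coeff-X^-other (γ G ℕ.+ j) k ≢k)) (ℕ.*-zeroʳ (d G (γ G ℕ.+ j))))

  coeff-term-same : ∀ j → coeff (term j) (γ G ℕ.+ j) ≡ d G (γ G ℕ.+ j)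
  coeff-term-same j =
    trans (coeff-· (d G (γ G ℕ.+ j)) (X ^ (γ G ℕ.+ j)) (γ G ℕ.+ j))
          (trans (cong (d G (γ G ℕ.+ j) ℕ.*_) (coeff-X^-same (γ G ℕ.+ j))) (ℕ.*-identityʳ _))

  -- Within the range of summation exactly one term has exponent `k`, the one of index `k ∸ γ G`;
  -- outside the range both sides vanish. From here on `γ` no longer matters.
  coeff-D : ∀ k → coeff (D G) k ≡ d G k
  coeff-D k with γ G ℕ.≤? k ×-dec k ℕ.≤? order
  ... | yes (γ≤k , k≤order) = begin
    coeff (D G) k
      ≡⟨ coeff-sum-single k term (ℕ.∸-monoˡ-< (s≤s k≤order) γ≤k)
           (λ i i≢ → coeff-term-other k i (λ { refl → i≢ (sym (ℕ.m+n∸m≡n (γ G) i)) })) ⟩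
    coeff (term (k ∸ γ G)) k
      ≡⟨ subst (λ x → coeff (term (k ∸ γ G)) x ≡ d G x) (ℕ.m+[n∸m]≡n γ≤k) (coeff-term-same (k ∸ γ G)) ⟩
    d G k ∎
    where open ≡-Reasoning
  ... | no  k∉ = trans
    (coeff-sum-zero k term (suc order ∸ γ G)
      (λ j j< → coeff-term-other k j (λ { refl → k∉ (ℕ.m≤m+n (γ G) j , ℕ.s≤s⁻¹ (bound j<)) })))
    (sym (d≡0 k k∉))
    where
    bound : ∀ {γ j o} → j < o ∸ γ → γ ℕ.+ j < o
    bound {zero}          j<  = j<
    bound {suc γ} {o = suc o} j< = s≤s (bound {γ} j<)

  D≈∑ : D G ≈ ∑ order (λ S → ⟦ does (dominating? G S) ⟧)
  D≈∑ k = trans (coeff-D k) (sym (coeff-∑ order (dominating? G) k))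

-- Domination in a chain as a Boolean condition on squares.

shift : ∀ {n} → QVertex n → QVertex (suc n)
shift (c j) = c (suc j)
shift (a i) = a (suc i)
shift (b i) = b (suc i)

-- Whether a vertex has a neighbour in the set m.  The flags L and R say whether
-- c zero and c (fromℕ n) also have a neighbour in the set outside the chain.
before after : ∀ {n} → (QVertex n → Bool) → Bool → Fin (suc n) → Bool
before m L zero    = L
before m L (suc i) = m (a i) ∨ m (b i)

after {zero}  m R zero    = R
after {suc n} m R zero    = m (a zero) ∨ m (b zero)
after {suc n} m R (suc j) = after (m ∘ shift) R j

near : ∀ {n} → (QVertex n → Bool) → Bool → Bool → QVertex n → Bool
near m L R (c j) = before m L j ∨ after m R j
near m L R (a i) = m (c (inject₁ i)) ∨ m (c (suc i))
near m L R (b i) = m (c (inject₁ i)) ∨ m (c (suc i))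

T-∨-introˡ : ∀ {x y} → T x → T (x ∨ y)
T-∨-introˡ = Equivalence.from T-∨ ∘ inj₁

T-∨-introʳ : ∀ {x y} → T y → T (x ∨ y)
T-∨-introʳ {x} = Equivalence.from (T-∨ {x}) ∘ inj₂

after-inject₁ : ∀ {n} (m : QVertex n → Bool) R i → after m R (inject₁ i) ≡ m (a i) ∨ m (b i)
after-inject₁ {suc n} m R zero    = refl
after-inject₁ {suc n} m R (suc i) = after-inject₁ (m ∘ shift) R i

after-fromℕ : ∀ n (m : QVertex n → Bool) R → after m R (fromℕ n) ≡ R
after-fromℕ zero    m R = refl
after-fromℕ (suc n) m R = after-fromℕ n (m ∘ shift) R

after-elim : ∀ {n} (m : QVertex n → Bool) R j → T (after m R j) →
             (∃ λ i → j ≡ inject₁ i × T (m (a i) ∨ m (b i))) ⊎ (j ≡ fromℕ n × T R)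
after-elim {zero}  m R zero    r  = inj₂ (refl , r)
after-elim {suc n} m R zero    ab = inj₁ (zero , refl , ab)
after-elim {suc n} m R (suc j) t with after-elim (m ∘ shift) R j t
... | inj₁ (i , refl , ab) = inj₁ (suc i , refl , ab)
... | inj₂ (refl , r)      = inj₂ (refl , r)

-- The left flag is false because nothing is attached at `c zero` in the graphs themselves; a true
-- left flag arises only when squares are cut off the front.
near-elim : ∀ {n} (m : QVertex n → Bool) R v → T (near m false R v) →
            (∃ λ u → T (m u) × SymClosure QEdge v u) ⊎ (v ≡ c (fromℕ n) × T R)
near-elim m R (a i) t with Equivalence.to T-∨ t
... | inj₁ c⁻ = inj₁ (_ , c⁻ , bwd (c⁻a i))
... | inj₂ c⁺ = inj₁ (_ , c⁺ , fwd (ac i))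
near-elim m R (b i) t with Equivalence.to T-∨ t
... | inj₁ c⁻ = inj₁ (_ , c⁻ , fwd (bc⁻ i))
... | inj₂ c⁺ = inj₁ (_ , c⁺ , bwd (cb i))
near-elim m R (c j) t with Equivalence.to (T-∨ {before m false j}) t
near-elim m R (c (suc i)) t | inj₁ ab with Equivalence.to T-∨ ab
... | inj₁ a∈ = inj₁ (_ , a∈ , bwd (ac i))
... | inj₂ b∈ = inj₁ (_ , b∈ , fwd (cb i))
near-elim m R (c j) t | inj₂ ab with after-elim m R j ab
... | inj₂ (refl , r) = inj₂ (refl , r)
... | inj₁ (i , refl , ab′) with Equivalence.to T-∨ ab′
... | inj₁ a∈ = inj₁ (_ , a∈ , fwd (c⁻a i))
... | inj₂ b∈ = inj₁ (_ , b∈ , bwd (bc⁻ i))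

-- A square is seen by `before` from its cut-vertex `c (suc i)` and by `after` from `c (inject₁ i)`;
-- the latter does not compute at `inject₁ i`, whence `after-inject₁`.
near-intro : ∀ {n} (m : QVertex n → Bool) L R {v u} →
             SymClosure QEdge v u → T (m u) → T (near m L R v)
near-intro m L R (fwd (c⁻a i)) u∈ = T-∨-introʳ {before m L (inject₁ i)}
  (subst T (sym (after-inject₁ m R i)) (T-∨-introˡ u∈))
near-intro m L R (fwd (ac i))  u∈ = T-∨-introʳ {m (c (inject₁ i))} u∈
near-intro m L R (fwd (cb i))  u∈ = T-∨-introˡ (T-∨-introʳ {m (a i)} u∈)
near-intro m L R (fwd (bc⁻ i)) u∈ = T-∨-introˡ u∈
near-intro m L R (bwd (c⁻a i)) u∈ = T-∨-introˡ u∈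
near-intro m L R (bwd (ac i))  u∈ = T-∨-introˡ (T-∨-introˡ u∈)
near-intro m L R (bwd (cb i))  u∈ = T-∨-introʳ {m (c (inject₁ i))} u∈
near-intro m L R (bwd (bc⁻ i)) u∈ = T-∨-introʳ {before m L (inject₁ i)}
  (subst T (sym (after-inject₁ m R i)) (T-∨-introʳ {m (a i)} u∈))

near-fromℕ : ∀ n (m : QVertex n → Bool) L R → T R → T (near m L R (c (fromℕ n)))
near-fromℕ n m L R r =
  T-∨-introʳ {before m L (fromℕ n)} (subst T (sym (after-fromℕ n m R)) r)

Covered : ∀ {n} → (QVertex n → Bool) → Bool → Bool → Set
Covered m L R = ∀ v → T (m v ∨ near m L R v)

-- The coverage of c zero, a zero and b zero in terms of the membership of
-- c zero, a zero, b zero and c (suc zero).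
firstSquare : (s L x y t : Bool) → Bool
firstSquare s L x y t = (s ∨ (L ∨ (x ∨ y))) ∧ ((x ∨ (s ∨ t)) ∧ (y ∨ (s ∨ t)))

-- When the first square is cut off, `c (suc zero)` becomes the first cut-vertex of the remaining
-- chain, and `a zero` and `b zero` become its neighbours outside; their disjunction is the new left
-- flag.
covered : ∀ {n} → (QVertex n → Bool) → Bool → Bool → Bool
covered {zero}  m L R = m (c zero) ∨ (L ∨ R)
covered {suc n} m L R =
  firstSquare (m (c zero)) L (m (a zero)) (m (b zero)) (m (c (suc zero)))
  ∧ covered (m ∘ shift) (m (a zero) ∨ m (b zero)) R

covered⇔ : ∀ {n} (m : QVertex n → Bool) L R → Covered m L R ⇔ T (covered m L R)
covered⇔ {zero}  m L R = mk⇔ (λ f → f (c zero)) (λ { t (c zero) → t })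
covered⇔ {suc n} m L R = mk⇔ to from
  where
  IH : Covered (m ∘ shift) (m (a zero) ∨ m (b zero)) R ⇔
       T (covered (m ∘ shift) (m (a zero) ∨ m (b zero)) R)
  IH = covered⇔ (m ∘ shift) (m (a zero) ∨ m (b zero)) R

  to : Covered m L R → T (covered m L R)
  to f = Equivalence.from T-∧
    ( Equivalence.from T-∧ (f (c zero) , Equivalence.from T-∧ (f (a zero) , f (b zero)))
    , Equivalence.to IH λ
        -- The two kinds of cut-vertices are separated because `before` computes only after this
        -- split; each condition then agrees definitionally with the one for the longer chain.
        { (c zero) → f (c (suc zero)) ; (c (suc j)) → f (c (suc (suc j)))
        ; (a i) → f (a (suc i)) ; (b i) → f (b (suc i)) })

  from : T (covered m L R) → Covered m L R
  from t with Equivalence.to T-∧ t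
  ... | sq , rest with Equivalence.to T-∧ sq
  ... | c₀ , ab with Equivalence.to T-∧ ab
  ... | a₀ , b₀ = λ
    { (c zero) → c₀ ; (a zero) → a₀ ; (b zero) → b₀
    ; (c (suc zero)) → Equivalence.from IH rest (c zero)
    ; (c (suc (suc j))) → Equivalence.from IH rest (c (suc j))
    ; (a (suc i)) → Equivalence.from IH rest (a i)
    ; (b (suc i)) → Equivalence.from IH rest (b i) }

-- Needed because the membership functions on a chain and on its tail are compared only pointwise.
covered-cong : ∀ {n} {m m′ : QVertex n → Bool} L R → (∀ v → m v ≡ m′ v) →
               covered m L R ≡ covered m′ L R
covered-cong {zero}  L R m≗m′ = cong (_∨ (L ∨ R)) (m≗m′ (c zero))
covered-cong {suc n} {m} {m′} L R m≗m′
  rewrite m≗m′ (c zero) | m≗m′ (a zero) | m≗m′ (b zero) | m≗m′ (c (suc zero)) =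
  cong (firstSquare (m′ (c zero)) L (m′ (a zero)) (m′ (b zero)) (m′ (c (suc zero))) ∧_)
       (covered-cong (m′ (a zero) ∨ m′ (b zero)) R (m≗m′ ∘ shift))

-- Dominating sets of `Q n` and `Q′ n`.

T-lookup : ∀ {n} {S : Subset n} {i} → T (lookup S i) ⇔ i ∈ S
T-lookup {S = S} {i} = mk⇔ (lookup⇒[]= i S ∘ Equivalence.to T-≡) (Equivalence.from T-≡ ∘ []=⇒lookup)

∉→⇒T-∨ : ∀ {n} (S : Subset n) i {x} → (i ∉ S → T x) → T (lookup S i ∨ x)
∉→⇒T-∨ S i f with T? (lookup S i)
... | yes i∈ = T-∨-introˡ i∈
... | no  i∉ = T-∨-introʳ {lookup S i} (f (i∉ ∘ Equivalence.from T-lookup))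

T-∨⇒∉→ : ∀ {n} (S : Subset n) i {x} → T (lookup S i ∨ x) → i ∉ S → T x
T-∨⇒∉→ S i t i∉ with Equivalence.to (T-∨ {lookup S i}) t
... | inj₁ i∈ = contradiction (Equivalence.to T-lookup i∈) i∉
... | inj₂ x  = x

module _ (n : ℕ) where
  private module Qₙ = Graph (Q n)

  Qmember : Subset Qₙ.order → QVertex n → Bool
  Qmember S v = lookup S (Qₙ.index v)

  -- The right flag is false as nothing is attached at `c (fromℕ n)`. The left flag stays free,
  -- since it changes when a square is cut off.
  Qdominates : Subset Qₙ.order → Bool → Bool
  Qdominates S L = covered (Qmember S) L false

  dominating-Q : ∀ S → Dominating (Q n) S ⇔ T (Qdominates S false)
  dominating-Q S = covered⇔ m false false ⇔-∘ mk⇔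
    (λ dom v → ∉→⇒T-∨ S (Qₙ.index v) λ v∉ → near-v (dom v v∉))
    (λ cov v v∉ → neighbour (near-elim m false v (T-∨⇒∉→ S (Qₙ.index v) (cov v) v∉)))
    where
    m : QVertex n → Bool
    m = Qmember S

    near-v : ∀ {v} → (∃ λ u → Qₙ.index u ∈ S × v Qₙ.~ u) → T (near m false false v)
    near-v (u , u∈ , v~u) = near-intro m false false v~u (Equivalence.from T-lookup u∈)

    neighbour : ∀ {v} → (∃ λ u → T (m u) × v Qₙ.~ u) ⊎ (v ≡ c (fromℕ n) × T false) →
                ∃ λ u → Qₙ.index u ∈ S × v Qₙ.~ u
    neighbour (inj₁ (u , u∈ , v~u)) = u , Equivalence.to T-lookup u∈ , v~u

  private module Q′ₙ = Graph (Q′ n)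

  Q′member : Subset Q′ₙ.order → QVertex n → Bool
  Q′member S v = lookup S (Q′ₙ.index (inj₁ v))

  pendant : Subset Q′ₙ.order → Fin 2 → Bool
  pendant S j = lookup S (Q′ₙ.index (inj₂ j))

  -- The pendant vertices supply the right flag of the chain. Each of them has `c (fromℕ n)` as its
  -- only neighbour, which gives the last two conditions.
  Q′dominates : Subset Q′ₙ.order → Bool → Bool
  Q′dominates S L =
    covered (Q′member S) L (pendant S zero ∨ pendant S (suc zero))
    ∧ ((pendant S zero ∨ Q′member S (c (fromℕ n))) ∧ (pendant S (suc zero) ∨ Q′member S (c (fromℕ n))))

  dominating-Q′ : ∀ S → Dominating (Q′ n) S ⇔ T (Q′dominates S false)
  dominating-Q′ S = mk⇔ to from
    where
    m : QVertex n → Bool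
    m = Q′member S
    R : Bool
    R = pendant S zero ∨ pendant S (suc zero)

    pendant⇒R : ∀ j → T (pendant S j) → T R
    pendant⇒R zero       = T-∨-introˡ
    pendant⇒R (suc zero) = T-∨-introʳ {pendant S zero}

    R⇒pendant : T R → ∃ λ j → T (pendant S j)
    R⇒pendant r with Equivalence.to T-∨ r
    ... | inj₁ p = zero , p
    ... | inj₂ p = suc zero , p

    to : Dominating (Q′ n) S → T (Q′dominates S false)
    to dom = Equivalence.from T-∧
      ( Equivalence.to (covered⇔ m false R)
          (λ v → ∉→⇒T-∨ S (Q′ₙ.index (inj₁ v)) λ v∉ → near-v (dom (inj₁ v) v∉))
      , Equivalence.from T-∧ (pendant-covered zero , pendant-covered (suc zero)))
      where
      near-v : ∀ {v} → (∃ λ u → Q′ₙ.index u ∈ S × inj₁ v Q′ₙ.~ u) → T (near m false R v)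
      near-v (inj₁ u , u∈ , v~u) = near-intro m false R v~u (Equivalence.from T-lookup u∈)
      near-v (inj₂ j , j∈ , refl) =
        near-fromℕ n m false R (pendant⇒R j (Equivalence.from T-lookup j∈))

      pendant-covered : ∀ j → T (pendant S j ∨ m (c (fromℕ n)))
      pendant-covered j = ∉→⇒T-∨ S (Q′ₙ.index (inj₂ j)) λ j∉ → cₙ∈ (dom (inj₂ j) j∉)
        where
        cₙ∈ : (∃ λ u → Q′ₙ.index u ∈ S × inj₂ j Q′ₙ.~ u) → T (m (c (fromℕ n)))
        cₙ∈ (inj₁ u , u∈ , refl) = Equivalence.from T-lookup u∈

    from : T (Q′dominates S false) → Dominating (Q′ n) S
    from t with Equivalence.to T-∧ t
    ... | cov , pend with Equivalence.to T-∧ pend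
    ... | p₀ , p₁ = dom
      where
      neighbour : ∀ v → (∃ λ u → T (m u) × v Qₙ.~ u) ⊎ (v ≡ c (fromℕ n) × T R) →
                  ∃ λ u → Q′ₙ.index u ∈ S × inj₁ v Q′ₙ.~ u
      neighbour v (inj₁ (u , u∈ , v~u)) = inj₁ u , Equivalence.to T-lookup u∈ , v~u
      neighbour v (inj₂ (v≡cₙ , r)) with R⇒pendant r
      ... | j , j∈ = inj₂ j , Equivalence.to T-lookup j∈ , v≡cₙ

      cₙ : ∀ j → T (pendant S j ∨ m (c (fromℕ n))) → Q′ₙ.index (inj₂ j) ∉ S →
           ∃ λ u → Q′ₙ.index u ∈ S × inj₂ j Q′ₙ.~ u
      cₙ j p j∉ = inj₁ (c (fromℕ n)) , Equivalence.to T-lookup (T-∨⇒∉→ S _ p j∉) , refl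

      dom : Dominating (Q′ n) S
      dom (inj₁ v) v∉ = neighbour v (near-elim m R v
        (T-∨⇒∉→ S (Q′ₙ.index (inj₁ v)) (Equivalence.from (covered⇔ m false R) cov v) v∉))
      dom (inj₂ zero)       = cₙ zero p₀
      dom (inj₂ (suc zero)) = cₙ (suc zero) p₁

-- Prepending a square as an operator on generating functions.

Qmember-shift : ∀ n {s x y t} S v →
  Qmember (suc n) (s ∷ x ∷ y ∷ t ∷ S) (shift v) ≡ Qmember n (t ∷ S) v
Qmember-shift n S (c zero)    = refl
Qmember-shift n S (c (suc j)) = refl
Qmember-shift n S (a i)       = refl
Qmember-shift n S (b i)       = refl

Q′member-shift : ∀ n {s x y t} S v →
  Q′member (suc n) (s ∷ x ∷ y ∷ t ∷ S) (shift v) ≡ Q′member n (t ∷ S) v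
Q′member-shift n S (c zero)    = refl
Q′member-shift n S (c (suc j)) = refl
Q′member-shift n S (a i)       = refl
Q′member-shift n S (b i)       = refl

-- Vertices are enumerated square by square, so dropping the entries of c₀, a₁ and b₁ leaves the
-- same set on the chain that starts at c₁.
Qdominates-suc : ∀ n s L x y t S → Qdominates (suc n) (s ∷ x ∷ y ∷ t ∷ S) L ≡
  firstSquare s L x y t ∧ Qdominates n (t ∷ S) (x ∨ y)
Qdominates-suc n s L x y t S =
  cong (firstSquare s L x y t ∧_) (covered-cong (x ∨ y) false (Qmember-shift n S))

-- The pendant vertices come last in the enumeration, so their entries and conditions are unaffected
-- by a square at the front.
Q′dominates-suc : ∀ n s L x y t S → Q′dominates (suc n) (s ∷ x ∷ y ∷ t ∷ S) L ≡
  firstSquare s L x y t ∧ Q′dominates n (t ∷ S) (x ∨ y)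
Q′dominates-suc n s L x y t S = trans
  (∧-assoc (firstSquare s L x y t) _ _)
  (cong (firstSquare s L x y t ∧_)
    (cong₂ (λ cov cₙ → cov ∧ ((p ∨ cₙ) ∧ (q ∨ cₙ)))
           (covered-cong (x ∨ y) (p ∨ q) (Q′member-shift n S))
           (Q′member-shift n {s} {x} {y} S (c (fromℕ n)))))
  where
  p = pendant n (t ∷ S) zero
  q = pendant n (t ∷ S) (suc zero)

-- s is the membership of c zero and L says whether c zero has a neighbour in the
-- set outside the chain; c zero itself does not contribute to the exponent.
Weights : Set
Weights = Bool → Bool → ℕ[X]

Qweights Q′weights : ℕ → Weights
Qweights  n s L = ∑ (n ℕ.* 3) (λ S → ⟦ Qdominates n (s ∷ S) L ⟧)
Q′weights n s L = ∑ (n ℕ.* 3 ℕ.+ 2) (λ S → ⟦ Q′dominates n (s ∷ S) L ⟧)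

squareTerm : Weights → Bool → Bool → Subset 3 → ℕ[X]
squareTerm w s L (x ∷ y ∷ t ∷ []) = if firstSquare s L x y t then w t (x ∨ y) else []

-- The transfer matrix on the four states of the first cut-vertex. The sum over three entries counts
-- a₁, b₁ and c₁ in the exponent; c₁ is the vertex that `w` leaves uncounted.
prependSquare : Weights → Weights
prependSquare w s L = ∑ 3 (squareTerm w s L)

-- Kept abstract in `f` and `g` so that it serves `Q` and `Q′` alike.
∑-square : ∀ {m} (f : Subset (3 ℕ.+ m) → Bool) (g : Bool → Bool → Subset m → Bool) s L →
           (∀ x y t S → f (x ∷ y ∷ t ∷ S) ≡ firstSquare s L x y t ∧ g t (x ∨ y) S) →
           ∑ (3 ℕ.+ m) (λ S → ⟦ f S ⟧) ≈ prependSquare (λ t e → ∑ m (λ S → ⟦ g t e S ⟧)) s L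
-- The sum over `3 ℕ.+ m` entries unfolds to a sum over the first three of sums over the rest, so a
-- comparison term by term is enough.
∑-square {m} f g s L f≡ = ∑-cong 3 {split} {squareTerm (λ t e → ∑ m (λ S → ⟦ g t e S ⟧)) s L} split≈
  where
  ∑-∧ : ∀ z (h : Subset m → Bool) →
        ∑ m (λ S → ⟦ z ∧ h S ⟧) ≈ (if z then ∑ m (λ S → ⟦ h S ⟧) else [])
  ∑-∧ true  h = λ _ → refl
  ∑-∧ false h = ∑-zero m

  split : Subset 3 → ℕ[X]
  split (x ∷ y ∷ t ∷ []) = ∑ m (λ S → ⟦ f (x ∷ y ∷ t ∷ S) ⟧)

  split≈ : ∀ U → split U ≈ squareTerm (λ t e → ∑ m (λ S → ⟦ g t e S ⟧)) s L U
  split≈ (x ∷ y ∷ t ∷ []) = begin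
    ∑ m (λ S → ⟦ f (x ∷ y ∷ t ∷ S) ⟧)
      ≈⟨ ∑-cong m (λ S k → cong (λ z → coeff ⟦ z ⟧ k) (f≡ x y t S)) ⟩
    ∑ m (λ S → ⟦ firstSquare s L x y t ∧ g t (x ∨ y) S ⟧)
      ≈⟨ ∑-∧ (firstSquare s L x y t) (g t (x ∨ y)) ⟩
    (if firstSquare s L x y t then ∑ m (λ S → ⟦ g t (x ∨ y) S ⟧) else []) ∎
    where open ≈-Reasoning

Qweights-suc : ∀ n s L → Qweights (suc n) s L ≈ prependSquare (Qweights n) s L
Qweights-suc n s L = ∑-square (λ S → Qdominates (suc n) (s ∷ S) L)
  (λ t e S → Qdominates n (t ∷ S) e) s L (Qdominates-suc n s L)

Q′weights-suc : ∀ n s L → Q′weights (suc n) s L ≈ prependSquare (Q′weights n) s L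
Q′weights-suc n s L = ∑-square (λ S → Q′dominates (suc n) (s ∷ S) L)
  (λ t e S → Q′dominates n (t ∷ S) e) s L (Q′dominates-suc n s L)

-- The recurrence as a linear relation between weights.

α₁ α₂ α′₂ α′₃ : ℕ[X]
α₁ = X ^ 3 + 2 · X ^ 2 + X
α₂ = X ^ 3 + 2 · X ^ 2
α′₂ = X ^ 3 + 3 · X ^ 2
α′₃ = 2 · X ^ 4 + 4 · X ^ 3

recurrence : (q₁ q₂ q′₂ q′₃ : ℕ[X]) → ℕ[X]
recurrence q₁ q₂ q′₂ q′₃ = α₁ * q₁ + α₂ * q₂ + α′₂ * q′₂ + α′₃ * q′₃

-- Handles the configurations of the first square that leave one of its vertices c₀, a₁, b₁
-- undominated.
recurrence-zero : [] ≈ recurrence [] [] [] []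
recurrence-zero = from-yes ([] ≈? recurrence [] [] [] [])

+-*-cong : ∀ p p′ q r r′ → p ≈ p′ → r ≈ r′ → p + q * r ≈ p′ + q * r′
+-*-cong p p′ q r r′ p≈p′ r≈r′ = +-cong p (q * r) p′ (q * r′) p≈p′ (*-congˡ q r r′ r≈r′)

recurrence-cong : ∀ q r s t q′ r′ s′ t′ → q ≈ q′ → r ≈ r′ → s ≈ s′ → t ≈ t′ →
                  recurrence q r s t ≈ recurrence q′ r′ s′ t′
recurrence-cong q r s t q′ r′ s′ t′ q≈q′ r≈r′ s≈s′ t≈t′ =
  +-*-cong (α₁ * q + α₂ * r + α′₂ * s) (α₁ * q′ + α₂ * r′ + α′₂ * s′) α′₃ t t′
    (+-*-cong (α₁ * q + α₂ * r) (α₁ * q′ + α₂ * r′) α′₂ s s′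
      (+-*-cong (α₁ * q) (α₁ * q′) α₂ r r′ (*-congˡ α₁ q q′ q≈q′) r≈r′)
      s≈s′)
    t≈t′

∑-+-* : ∀ n (f : Subset n → ℕ[X]) p (g : Subset n → ℕ[X]) q → ∑ n f ≈ q →
        ∑ n (λ S → f S + p * g S) ≈ q + p * ∑ n g
∑-+-* n f p g q ∑f≈q = begin
  ∑ n (λ S → f S + p * g S)      ≈⟨ ∑-+ n f (λ S → p * g S) ⟩
  ∑ n f + ∑ n (λ S → p * g S)    ≈⟨ +-cong (∑ n f) (∑ n (λ S → p * g S)) q (p * ∑ n g) ∑f≈q (∑-* n p g) ⟩
  q + p * ∑ n g                  ∎
  where open ≈-Reasoning

-- `∑` is linear over polynomials; the four products are peeled off from the right.
∑-recurrence : ∀ n (q r s t : Subset n → ℕ[X]) →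
  ∑ n (λ S → recurrence (q S) (r S) (s S) (t S)) ≈ recurrence (∑ n q) (∑ n r) (∑ n s) (∑ n t)
∑-recurrence n q r s t =
  ∑-+-* n (λ S → α₁ * q S + α₂ * r S + α′₂ * s S) α′₃ t
          (α₁ * ∑ n q + α₂ * ∑ n r + α′₂ * ∑ n s) $
  ∑-+-* n (λ S → α₁ * q S + α₂ * r S) α′₂ s (α₁ * ∑ n q + α₂ * ∑ n r) $
  ∑-+-* n (λ S → α₁ * q S) α₂ r (α₁ * ∑ n q) $
  ∑-* n α₁ q

Recurrence : (w w₁ w₂ w′₂ w′₃ : Weights) → Set
Recurrence w w₁ w₂ w′₂ w′₃ =
  ∀ s L → w s L ≈ recurrence (w₁ s L) (w₂ s L) (w′₂ s L) (w′₃ s L)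

-- All five weights meet the same test `firstSquare`, so each of the eight configurations
-- contributes either the relation in state `t`, `x ∨ y` or the trivial relation between zeros.
-- Linearity adds them up.
prependSquare-recurrence : ∀ w w₁ w₂ w′₂ w′₃ → Recurrence w w₁ w₂ w′₂ w′₃ →
  Recurrence (prependSquare w) (prependSquare w₁) (prependSquare w₂)
             (prependSquare w′₂) (prependSquare w′₃)
prependSquare-recurrence w w₁ w₂ w′₂ w′₃ rec s L = begin
  ∑ 3 (squareTerm w s L)
    ≈⟨ ∑-cong 3 {squareTerm w s L} {λ U → recurrence (squareTerm w₁ s L U) (squareTerm w₂ s L U)
                                       (squareTerm w′₂ s L U) (squareTerm w′₃ s L U)} termwise ⟩
  ∑ 3 (λ U → recurrence (squareTerm w₁ s L U) (squareTerm w₂ s L U)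
                        (squareTerm w′₂ s L U) (squareTerm w′₃ s L U))
    ≈⟨ ∑-recurrence 3 (squareTerm w₁ s L) (squareTerm w₂ s L)
                      (squareTerm w′₂ s L) (squareTerm w′₃ s L) ⟩
  recurrence (prependSquare w₁ s L) (prependSquare w₂ s L)
             (prependSquare w′₂ s L) (prependSquare w′₃ s L) ∎
  where
  open ≈-Reasoning
  termwise : ∀ U → squareTerm w s L U ≈ recurrence (squareTerm w₁ s L U) (squareTerm w₂ s L U)
                                                   (squareTerm w′₂ s L U) (squareTerm w′₃ s L U)
  termwise (x ∷ y ∷ t ∷ []) with firstSquare s L x y t
  ... | true  = rec t (x ∨ y)
  ... | false = recurrence-zero

-- In a concrete state these are closed polynomials, sums over at most 512 subsets, so the base case
-- is decided by evaluation.
base? : ∀ s L → Dec (Qweights 3 s L ≈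
  recurrence (Qweights 2 s L) (Qweights 1 s L) (Q′weights 1 s L) (Q′weights 0 s L))
base? s L = Qweights 3 s L ≈?
  recurrence (Qweights 2 s L) (Qweights 1 s L) (Q′weights 1 s L) (Q′weights 0 s L)

-- The recurrence for D alone would not survive prepending a square; it has to be
-- proved for all four boundary conditions at once.
weights-recurrence : ∀ n → Recurrence (Qweights (3 ℕ.+ n)) (Qweights (2 ℕ.+ n)) (Qweights (1 ℕ.+ n))
                                      (Q′weights (1 ℕ.+ n)) (Q′weights n)
weights-recurrence zero false false = from-yes (base? false false)
weights-recurrence zero false true  = from-yes (base? false true)
weights-recurrence zero true  false = from-yes (base? true false)
weights-recurrence zero true  true  = from-yes (base? true true)
weights-recurrence (suc n) s L = begin
  Qweights (4 ℕ.+ n) s L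
    ≈⟨ Qweights-suc (3 ℕ.+ n) s L ⟩
  prependSquare (Qweights (3 ℕ.+ n)) s L
    ≈⟨ prependSquare-recurrence
         (Qweights (3 ℕ.+ n)) (Qweights (2 ℕ.+ n)) (Qweights (1 ℕ.+ n))
         (Q′weights (1 ℕ.+ n)) (Q′weights n) (weights-recurrence n) s L ⟩
  recurrence (prependSquare (Qweights (2 ℕ.+ n)) s L) (prependSquare (Qweights (1 ℕ.+ n)) s L)
             (prependSquare (Q′weights (1 ℕ.+ n)) s L) (prependSquare (Q′weights n) s L)
    ≈⟨ recurrence-cong
         (Qweights (3 ℕ.+ n) s L) (Qweights (2 ℕ.+ n) s L)
         (Q′weights (2 ℕ.+ n) s L) (Q′weights (1 ℕ.+ n) s L)
         (prependSquare (Qweights (2 ℕ.+ n)) s L) (prependSquare (Qweights (1 ℕ.+ n)) s L)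
         (prependSquare (Q′weights (1 ℕ.+ n)) s L) (prependSquare (Q′weights n) s L)
         (Qweights-suc (2 ℕ.+ n) s L) (Qweights-suc (1 ℕ.+ n) s L)
         (Q′weights-suc (1 ℕ.+ n) s L) (Q′weights-suc n s L) ⟨
  recurrence (Qweights (3 ℕ.+ n) s L) (Qweights (2 ℕ.+ n) s L)
             (Q′weights (2 ℕ.+ n) s L) (Q′weights (1 ℕ.+ n) s L) ∎
  where open ≈-Reasoning

-- From weights back to domination polynomials.

total : Weights → ℕ[X]
total w = w false false + (0 ∷ w true false)

-- `total` is by definition a `∑ 1` over the membership of `c zero`, restoring the factor `X` that
-- weights omit, so linearity applies once more. Only the states with left flag false enter.
total-recurrence : ∀ w w₁ w₂ w′₂ w′₃ → Recurrence w w₁ w₂ w′₂ w′₃ →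
  total w ≈ recurrence (total w₁) (total w₂) (total w′₂) (total w′₃)
total-recurrence w w₁ w₂ w′₂ w′₃ rec = begin
  total w
    ≈⟨ ∑-cong 1 {λ { (s ∷ []) → w s false }}
                {λ U → recurrence (at w₁ U) (at w₂ U) (at w′₂ U) (at w′₃ U)}
                (λ { (s ∷ []) → rec s false }) ⟩
  ∑ 1 (λ U → recurrence (at w₁ U) (at w₂ U) (at w′₂ U) (at w′₃ U))
    ≈⟨ ∑-recurrence 1 (at w₁) (at w₂) (at w′₂) (at w′₃) ⟩
  recurrence (total w₁) (total w₂) (total w′₂) (total w′₃) ∎
  where
  open ≈-Reasoning
  at : Weights → Subset 1 → ℕ[X]
  at w (s ∷ []) = w s false

⟦does⟧ : ∀ {A : Set} (A? : Dec A) {z} → A ⇔ T z → ⟦ does A? ⟧ ≈ ⟦ z ⟧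
⟦does⟧ A? {z} A⇔z k = cong (λ z → coeff ⟦ z ⟧ k) (does-⇔ A⇔z A? (T? z))

D-Q : ∀ n → D (Q n) ≈ total (Qweights n)
D-Q n = begin
  D (Q n)                                                ≈⟨ D≈∑ (Q n) ⟩
  ∑ (1 ℕ.+ n ℕ.* 3) (λ S → ⟦ does (dominating? (Q n) S) ⟧)
    ≈⟨ ∑-cong (1 ℕ.+ n ℕ.* 3) {λ S → ⟦ does (dominating? (Q n) S) ⟧} {λ S → ⟦ Qdominates n S false ⟧}
         (λ S → ⟦does⟧ (dominating? (Q n) S) (dominating-Q n S)) ⟩
  -- `c zero` is first in the enumeration, so the outermost step of `∑` is exactly the splitting in
  -- `total`.
  total (Qweights n)                                     ∎
  where open ≈-Reasoning

D-Q′ : ∀ n → D (Q′ n) ≈ total (Q′weights n)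
D-Q′ n = begin
  D (Q′ n)                                               ≈⟨ D≈∑ (Q′ n) ⟩
  ∑ (1 ℕ.+ n ℕ.* 3 ℕ.+ 2) (λ S → ⟦ does (dominating? (Q′ n) S) ⟧)
    ≈⟨ ∑-cong (1 ℕ.+ n ℕ.* 3 ℕ.+ 2) {λ S → ⟦ does (dominating? (Q′ n) S) ⟧} {λ S → ⟦ Q′dominates n S false ⟧}
         (λ S → ⟦does⟧ (dominating? (Q′ n) S) (dominating-Q′ n S)) ⟩
  total (Q′weights n)                                    ∎
  where open ≈-Reasoning

D-recurrence : ∀ n → D (Q (3 ℕ.+ n)) ≈
  recurrence (D (Q (2 ℕ.+ n))) (D (Q (1 ℕ.+ n))) (D (Q′ (1 ℕ.+ n))) (D (Q′ n))
D-recurrence n = begin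
  D (Q (3 ℕ.+ n))                       ≈⟨ D-Q (3 ℕ.+ n) ⟩
  total (Qweights (3 ℕ.+ n))
    ≈⟨ total-recurrence
         (Qweights (3 ℕ.+ n)) (Qweights (2 ℕ.+ n)) (Qweights (1 ℕ.+ n))
         (Q′weights (1 ℕ.+ n)) (Q′weights n) (weights-recurrence n) ⟩
  recurrence (total (Qweights (2 ℕ.+ n))) (total (Qweights (1 ℕ.+ n)))
             (total (Q′weights (1 ℕ.+ n))) (total (Q′weights n))
    ≈⟨ recurrence-cong
         (D (Q (2 ℕ.+ n))) (D (Q (1 ℕ.+ n))) (D (Q′ (1 ℕ.+ n))) (D (Q′ n))
         (total (Qweights (2 ℕ.+ n))) (total (Qweights (1 ℕ.+ n)))
         (total (Q′weights (1 ℕ.+ n))) (total (Q′weights n))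
         (D-Q (2 ℕ.+ n)) (D-Q (1 ℕ.+ n)) (D-Q′ (1 ℕ.+ n)) (D-Q′ n) ⟨
  recurrence (D (Q (2 ℕ.+ n))) (D (Q (1 ℕ.+ n))) (D (Q′ (1 ℕ.+ n))) (D (Q′ n)) ∎
  where open ≈-Reasoning

theorem7 : (∀ (n : ℕ) → 3 ≤ n →
    D (Q n) ≈
    (X ^ 3 + 2 · X ^ 2 + X) * D (Q (n ∸ 1))
    + (X ^ 3 + 2 · X ^ 2) * D (Q (n ∸ 2))
    + (X ^ 3 + 3 · X ^ 2) * D (Q′ (n ∸ 2))
    + (2 · X ^ 4 + 4 · X ^ 3) * D (Q′ (n ∸ 3)))
    × (D (Q 1) ≈ X ^ 4 + 4 · X ^ 3 + 6 · X ^ 2)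
    × (D (Q 2) ≈ X ^ 7 + 7 · X ^ 6 + 21 · X ^ 5 + 29 · X ^ 4 + 15 · X ^ 3)
-- Matching on `3 ≤ n` makes the truncated subtractions compute.
theorem7 = (λ { (suc (suc (suc n))) (s≤s (s≤s (s≤s z≤n))) → D-recurrence n })
         -- `D-Q` replaces the initial polynomials by closed sums of Boolean tests, which evaluation
         -- compares with the stated values.
         , (λ k → trans (D-Q 1 k) (from-yes (total (Qweights 1) ≈? X ^ 4 + 4 · X ^ 3 + 6 · X ^ 2) k))
         , (λ k → trans (D-Q 2 k)
                    (from-yes (total (Qweights 2) ≈? X ^ 7 + 7 · X ^ 6 + 21 · X ^ 5 + 29 · X ^ 4 + 15 · X ^ 3) k))
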